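{- Let $p$ be a prime, $m\in\mathbb{N}$ with $m\ge 1$, $n=p^m$, and $S=\{a\in\mathbb{Z}_n \mid \gcd(a,n)=1\}$. Then the Cayley graph $\Gamma=\mathrm{Cay}(\mathbb{Z}_n,S)$ is an integral graph.
   Context: For a finite group $G$ and an inverse-closed subset $H\subseteq G$ not containing the identity, $\mathrm{Cay}(G,H)$ is the simple undirected graph with vertex set $G$ in which $x,y$ are adjacent iff $x^{ -1}y\in H$. Here $G=\mathbb{Z}_n$ is the additive cyclic group, so $x,y$ are adjacent iff $y-x\in S$. A graph is integral if all eigenvalues of its adjacency matrix are integers. -}

module Defs where

open import Level using (Level; 0ℓ; _⊔_) renaming (suc to lsuc)
open import Algebra.Apartness.Bundles using (HeytingField; HeytingCommutativeRing)
open import Algebra.Bundles using (Group; CommutativeRing)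
import Algebra.Definitions.RawMonoid as RawMonoidDefinitions
import Algebra.Properties.Group as GroupProperties
open import Algebra.Structures using (IsGroup)
open import Data.Bool.Base using (if_then_else_)
open import Data.Fin.Base using (Fin; toℕ)
open import Data.Fin.Properties using (toℕ-fromℕ<; toℕ-injective; toℕ<n)
open import Data.Integer.Base using (ℤ; +_; -[1+_])
open import Data.Nat.Base using (ℕ; suc; _+_; _∸_; _^_; _<_; _≥_; NonZero; >-nonZero⁻¹; nonTrivial⇒n>1; n>1⇒nonTrivial; nonTrivial⇒≢1)
open import Data.Nat.Coprimality using (Coprime; gcd≡1⇒coprime; coprime⇒gcd≡1)
open import Data.Nat.Divisibility using (_∣_; ∣n∣m%n⇒∣m; ∣m+n∣m⇒∣n)
open import Data.Nat.DivMod using (_%_; _mod_; m%n<n; m<n⇒m%n≡m; n%n≡0; %-distribˡ-+; m%n%n≡m%n)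
open import Data.Nat.GCD using (gcd; gcd-identityˡ)
open import Data.Nat.Primality using (Prime; prime⇒nonTrivial; prime⇒nonZero)
open import Data.Nat.Properties using (+-comm; +-assoc; m∸n+n≡m; <⇒≤; <-≤-trans; m≤m*n; m^n≢0; _≟_)
open import Data.Product.Base using (_×_; _,_; ∃-syntax)
open import Data.Vec.Functional using (Vector)
open import Relation.Binary.Core using (Rel)
import Relation.Binary.Definitions as B
open import Relation.Binary.PropositionalEquality using (_≡_; sym; trans; cong; cong₂; subst; isEquivalence; module ≡-Reasoning)
open import Relation.Nullary.Decidable.Core using (does)
open import Relation.Nullary.Negation.Core using (¬_)
open import Relation.Unary using (Pred; Decidable)

record SimpleGraph : Set₁ where
  field
    order  : ℕ
    Adj    : Rel (Fin order) 0ℓ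
    adj?   : B.Decidable Adj
    symm   : B.Symmetric Adj
    irrefl : ∀ {x} → ¬ Adj x x

record FiniteGroup : Set where
  infixl 7 _∙_
  infix  8 _⁻¹
  field
    order   : ℕ
    _∙_     : Fin order → Fin order → Fin order
    ε       : Fin order
    _⁻¹     : Fin order → Fin order
    isGroup : IsGroup _≡_ _∙_ ε _⁻¹

  group : Group 0ℓ 0ℓ
  group = record { isGroup = isGroup }

  open IsGroup isGroup public using (inverseˡ)

record ConnectionSet (G : FiniteGroup) : Set₁ where
  open FiniteGroup G
  field
    Member         : Pred (Fin order) 0ℓ
    member?        : Decidable Member
    inverse-closed : ∀ {x} → Member x → Member (x ⁻¹)
    ε∉             : ¬ Member ε

Cay : (G : FiniteGroup) → ConnectionSet G → SimpleGraph
Cay G H = record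
  { order  = order
  ; Adj    = λ x y → Member (x ⁻¹ ∙ y)
  ; adj?   = λ x y → member? (x ⁻¹ ∙ y)
  ; symm   = λ {x} {y} h → subst Member (flip-inverse x y) (inverse-closed h)
  ; irrefl = λ {x} h → ε∉ (subst Member (inverseˡ x) h)
  }
  where
  open FiniteGroup G
  open ConnectionSet H
  open GroupProperties group using (⁻¹-anti-homo-∙; ⁻¹-involutive)

  flip-inverse : ∀ x y → (x ⁻¹ ∙ y) ⁻¹ ≡ y ⁻¹ ∙ x
  flip-inverse x y =
    trans (⁻¹-anti-homo-∙ (x ⁻¹) y) (cong (y ⁻¹ ∙_) (⁻¹-involutive x))

-- HeytingField only requires an apartness relation _#_, so that both
-- discrete fields and the constructive real and complex numbers are
-- instances; "nonzero" is rendered as "# 0#".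
module _ {c ℓ₁ ℓ₂ : Level} (K : HeytingField c ℓ₁ ℓ₂) where
  private module K = HeytingField K
  open CommutativeRing (HeytingCommutativeRing.commutativeRing K.heytingCommutativeRing)
    using (+-rawMonoid)
  open RawMonoidDefinitions +-rawMonoid using (sum) renaming (_×_ to _·_)

  CharacteristicZero : Set ℓ₂
  CharacteristicZero = ∀ k → (suc k · K.1#) K.# K.0#

  fromℤ : ℤ → K.Carrier
  fromℤ (+ k)    = k · K.1#
  fromℤ -[1+ k ] = K.- (suc k · K.1#)

  SquareMatrix : ℕ → Set c
  SquareMatrix n = Fin n → Fin n → K.Carrier

  _*ᵥ_ : ∀ {n} → SquareMatrix n → Vector K.Carrier n → Vector K.Carrier n
  (A *ᵥ v) i = sum (λ j → A i j K.* v j)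

  IsEigenvalue : ∀ {n} → SquareMatrix n → K.Carrier → Set (c ⊔ ℓ₁ ⊔ ℓ₂)
  IsEigenvalue {n} A μ =
    ∃[ v ] (∃[ i ] v i K.# K.0#) × (∀ (i : Fin n) → (A *ᵥ v) i K.≈ μ K.* v i)

  IsInteger : K.Carrier → Set ℓ₁
  IsInteger μ = ∃[ z ] μ K.≈ fromℤ z

  adjacencyMatrix : (Γ : SimpleGraph) → SquareMatrix (SimpleGraph.order Γ)
  adjacencyMatrix Γ i j = if does (SimpleGraph.adj? Γ i j) then K.1# else K.0#

-- The library has no ℂ. Eigenvalues are therefore taken in an arbitrary
-- field of characteristic zero. Such fields include ℂ, and since the
-- eigenvalues of a 0/1-matrix are algebraic over ℚ, requiring integrality
-- over all of them is (classically) the same as requiring it over ℂ.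
IsIntegral : (c ℓ₁ ℓ₂ : Level) → SimpleGraph → Set (lsuc (c ⊔ ℓ₁ ⊔ ℓ₂))
IsIntegral c ℓ₁ ℓ₂ Γ =
  (K : HeytingField c ℓ₁ ℓ₂) → CharacteristicZero K →
  ∀ μ → IsEigenvalue K (adjacencyMatrix K Γ) μ → IsInteger K μ

module _ (n : ℕ) .{{_ : NonZero n}} where

  _⊕_ : Fin n → Fin n → Fin n
  x ⊕ y = (toℕ x + toℕ y) mod n

  ⊖_ : Fin n → Fin n
  ⊖ x = (n ∸ toℕ x) mod n

  𝟘 : Fin n
  𝟘 = 0 mod n

  toℕ-mod : ∀ k → toℕ (k mod n) ≡ k % n
  toℕ-mod k = toℕ-fromℕ< (m%n<n k n)

  0%n≡0 : 0 % n ≡ 0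
  0%n≡0 = m<n⇒m%n≡m (>-nonZero⁻¹ n)

  mod-cong : ∀ {k l} → k % n ≡ l % n → k mod n ≡ l mod n
  mod-cong {k} {l} eq =
    toℕ-injective (trans (toℕ-mod k) (trans eq (sym (toℕ-mod l))))

  mod-toℕ : ∀ x → toℕ x mod n ≡ x
  mod-toℕ x = toℕ-injective (trans (toℕ-mod (toℕ x)) (m<n⇒m%n≡m (toℕ<n x)))

  %-+ˡ : ∀ k l → (k % n + l) % n ≡ (k + l) % n
  %-+ˡ k l = begin
    (k % n + l) % n          ≡⟨ %-distribˡ-+ (k % n) l n ⟩
    (k % n % n + l % n) % n  ≡⟨ cong (λ z → (z + l % n) % n) (m%n%n≡m%n k n) ⟩
    (k % n + l % n) % n      ≡⟨ %-distribˡ-+ k l n ⟨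
    (k + l) % n              ∎
    where open ≡-Reasoning

  mod-⊕ : ∀ k y → (k mod n) ⊕ y ≡ (k + toℕ y) mod n
  mod-⊕ k y = mod-cong (trans (cong (λ z → (z + toℕ y) % n) (toℕ-mod k)) (%-+ˡ k (toℕ y)))

  ⊕-comm : ∀ x y → x ⊕ y ≡ y ⊕ x
  ⊕-comm x y = cong (_mod n) (+-comm (toℕ x) (toℕ y))

  ⊕-assoc : ∀ x y z → (x ⊕ y) ⊕ z ≡ x ⊕ (y ⊕ z)
  ⊕-assoc x y z = begin
    (x ⊕ y) ⊕ z                        ≡⟨ mod-⊕ (toℕ x + toℕ y) z ⟩
    (toℕ x + toℕ y + toℕ z) mod n      ≡⟨ cong (_mod n) (+-assoc (toℕ x) (toℕ y) (toℕ z)) ⟩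
    (toℕ x + (toℕ y + toℕ z)) mod n    ≡⟨ cong (_mod n) (+-comm (toℕ x) (toℕ y + toℕ z)) ⟩
    (toℕ y + toℕ z + toℕ x) mod n      ≡⟨ mod-⊕ (toℕ y + toℕ z) x ⟨
    (y ⊕ z) ⊕ x                        ≡⟨ ⊕-comm (y ⊕ z) x ⟩
    x ⊕ (y ⊕ z)                        ∎
    where open ≡-Reasoning

  ⊕-identityˡ : ∀ x → 𝟘 ⊕ x ≡ x
  ⊕-identityˡ x = trans (mod-⊕ 0 x) (mod-toℕ x)

  ⊕-inverseˡ : ∀ x → (⊖ x) ⊕ x ≡ 𝟘
  ⊕-inverseˡ x = begin
    (⊖ x) ⊕ x                  ≡⟨ mod-⊕ (n ∸ toℕ x) x ⟩
    (n ∸ toℕ x + toℕ x) mod n  ≡⟨ cong (_mod n) (m∸n+n≡m (<⇒≤ (toℕ<n x))) ⟩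
    n mod n                    ≡⟨ mod-cong (trans (n%n≡0 n) (sym 0%n≡0)) ⟩
    𝟘                          ∎
    where open ≡-Reasoning

  ℤmod : FiniteGroup
  ℤmod = record
    { order   = n
    ; _∙_     = _⊕_
    ; ε       = 𝟘
    ; _⁻¹     = ⊖_
    ; isGroup = record
      { isMonoid = record
        { isSemigroup = record
          { isMagma = record { isEquivalence = isEquivalence ; ∙-cong = cong₂ _⊕_ }
          ; assoc   = ⊕-assoc
          }
        ; identity = ⊕-identityˡ , λ x → trans (⊕-comm x 𝟘) (⊕-identityˡ x)
        }
      ; inverse = ⊕-inverseˡ , λ x → trans (⊕-comm x (⊖ x)) (⊕-inverseˡ x)
      ; ⁻¹-cong = cong ⊖_
      }
    }

  𝟘-gcd : gcd (toℕ 𝟘) n ≡ n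
  𝟘-gcd = trans (cong (λ z → gcd z n) (trans (toℕ-mod 0) 0%n≡0)) (gcd-identityˡ n)

  ⊖-gcd : ∀ {x} → gcd (toℕ x) n ≡ 1 → gcd (toℕ (⊖ x)) n ≡ 1
  ⊖-gcd {x} g = coprime⇒gcd≡1 coprime
    where
    coprime : Coprime (toℕ (⊖ x)) n
    coprime {d} (d∣⊖x , d∣n) = gcd≡1⇒coprime g (d∣x , d∣n)
      where
      d∣n∸x : d ∣ n ∸ toℕ x
      d∣n∸x = ∣n∣m%n⇒∣m d∣n (subst (d ∣_) (toℕ-mod (n ∸ toℕ x)) d∣⊖x)
      d∣x : d ∣ toℕ x
      d∣x = ∣m+n∣m⇒∣n (subst (d ∣_) (sym (m∸n+n≡m (<⇒≤ (toℕ<n x)))) d∣n) d∣n∸x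

  -- For n = 1 the identity 0 satisfies gcd(0,1) = 1, hence 1 < n.
  coprimeResidues : 1 < n → ConnectionSet ℤmod
  coprimeResidues 1<n = record
    { Member         = λ a → gcd (toℕ a) n ≡ 1
    ; member?        = λ a → gcd (toℕ a) n ≟ 1
    ; inverse-closed = λ {a} → ⊖-gcd {a}
    ; ε∉             = λ g → nonTrivial⇒≢1 {{n>1⇒nonTrivial 1<n}} (trans (sym 𝟘-gcd) g)
    }

primePower-nonZero : ∀ {p} m → Prime p → NonZero (p ^ m)
primePower-nonZero {p} m p-prime = m^n≢0 p m {{prime⇒nonZero p-prime}}

1<primePower : ∀ {p m} → Prime p → m ≥ 1 → 1 < p ^ m
1<primePower {p} {suc k} p-prime _ =
  <-≤-trans (nonTrivial⇒n>1 p {{prime⇒nonTrivial p-prime}})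
            (m≤m*n p (p ^ k) {{primePower-nonZero k p-prime}})

{-# OPTIONS --safe #-}

-- Put q = p^(m-1), let J be the all-ones matrix and E the indicator matrix of
-- congruence modulo p. Since gcd(a, p^m) = 1 iff p ∤ a, the adjacency matrix
-- is A = J - E. If A v = μ v and s is the sum of the entries of v, then
-- s = μ vₓ + (E v)ₓ for all x. Summing this over all x, respectively over one
-- congruence class, yields (p^m - q) s = μ s and q s = (μ + q) (E v)ₓ. Hence
-- (μ - (p^m - q)) (μ + q) μ v = 0. The three roots are pairwise apart in
-- characteristic zero, so cotransitivity shows μ to be apart from two of them,
-- and μ then equals the third.
module Submission where

open import Defs
open import Level using (Level)
open import Algebra.Apartness.Bundles using (HeytingField; HeytingCommutativeRing)
import Algebra.Apartness.Properties.HeytingCommutativeRing as HeytingProperties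
open import Algebra.Bundles using (CommutativeRing)
import Algebra.Properties.Ring as RingProperties
import Algebra.Properties.Semiring.Mult as SemiringMult
import Algebra.Properties.Semiring.Sum as SemiringSum
open import Data.Bool.Base using (if_then_else_)
open import Data.Fin.Base using (Fin; toℕ)
open import Data.Fin.Properties using (toℕ<n)
open import Data.Integer.Base as ℤ using (+_)
open import Data.Nat.Base as ℕ using (ℕ; zero; suc; _^_; _≥_; _<_; NonZero; s<s⁻¹)
open import Data.Nat.Coprimality using (Coprime; coprime-divisor; coprime⇒gcd≡1; gcd≡1⇒coprime)
open import Data.Nat.Divisibility using (_∣_; _∤_; ∣-trans; ∣-refl; ∣1⇒≡1; m∣m*n; n∣m*n; ∣m+n∣m⇒∣n)
open import Data.Nat.DivMod using (_%_; _/_; m≡m%n+[m/n]*n; m%n<n; m<n⇒m%n≡m; m∣n⇒o%n%m≡o%m; %-remove-+ˡ; %-remove-+ʳ)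
open import Data.Nat.Primality using (Prime; prime⇒irreducible; ¬prime[0]; ¬prime[1])
import Data.Nat.Properties as ℕ
open import Data.Product.Base using (_,_; proj₁)
open import Data.Sum.Base as Sum using (_⊎_; inj₁; inj₂)
open import Data.Vec.Functional using (Vector)
open import Function.Base using (_∘_)
open import Relation.Binary.PropositionalEquality as ≡ using (_≡_)
import Relation.Binary.Reasoning.Setoid as SetoidReasoning
open import Relation.Nullary.Decidable.Core using (Dec; yes; no; does; decidable-stable)
open import Relation.Nullary.Negation.Core using (¬_; contradiction)

private variable
  c ℓ₁ ℓ₂ : Level

-- Coprimality to a prime power.

∤⇒coprime-^ : ∀ {p a} m → Prime p → p ∤ a → Coprime a (p ^ m)
∤⇒coprime-^ zero p-prime p∤a (d∣a , d∣1) = ∣1⇒≡1 d∣1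
∤⇒coprime-^ {p} {a} (suc k) p-prime p∤a {d} (d∣a , d∣p^m) =
  -- As `d` is coprime to `p`, Euclid's lemma strips one factor `p` from the power.
  ∤⇒coprime-^ k p-prime p∤a (d∣a , coprime-divisor d-coprime-p d∣p^m)
  where
  d-coprime-p : Coprime d p
  d-coprime-p {e} (e∣d , e∣p) with prime⇒irreducible p-prime e∣p
  ... | inj₁ e≡1 = e≡1
  ... | inj₂ ≡.refl = contradiction (∣-trans e∣d d∣a) p∤a

-- Congruence modulo `p` and differences of residues.

module _ {p : ℕ} .{{_ : NonZero p}} where

  -- Cancelling the common remainder leaves `n` plus a multiple of `p` equal to a multiple of `p`.
  [m+n]%p≡m%p⇒p∣n : ∀ m n → (m ℕ.+ n) % p ≡ m % p → p ∣ n
  [m+n]%p≡m%p⇒p∣n m n eq = ∣m+n∣m⇒∣n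
    (≡.subst (p ∣_) (≡.sym (ℕ.+-cancelˡ-≡ (m % p) _ _ (begin
      m % p ℕ.+ (m / p ℕ.* p ℕ.+ n)                  ≡⟨ ℕ.+-assoc (m % p) _ n ⟨
      m % p ℕ.+ m / p ℕ.* p ℕ.+ n                    ≡⟨ ≡.cong (ℕ._+ n) (m≡m%n+[m/n]*n m p) ⟨
      m ℕ.+ n                                        ≡⟨ m≡m%n+[m/n]*n (m ℕ.+ n) p ⟩
      (m ℕ.+ n) % p ℕ.+ (m ℕ.+ n) / p ℕ.* p          ≡⟨ ≡.cong (ℕ._+ (m ℕ.+ n) / p ℕ.* p) eq ⟩
      m % p ℕ.+ (m ℕ.+ n) / p ℕ.* p                  ∎)))
      (n∣m*n ((m ℕ.+ n) / p)))
    (n∣m*n (m / p))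
    where open ≡.≡-Reasoning

  module _ {n : ℕ} .{{_ : NonZero n}} (p∣n : p ∣ n) (x y : Fin n) where

    private
      d : Fin n
      d = _⊕_ n (⊖_ n x) y

      x⊕d≡y : _⊕_ n x d ≡ y
      x⊕d≡y = begin
        _⊕_ n x (_⊕_ n (⊖_ n x) y)  ≡⟨ ⊕-assoc n x (⊖_ n x) y ⟨
        _⊕_ n (_⊕_ n x (⊖_ n x)) y  ≡⟨ ≡.cong (λ z → _⊕_ n z y) (⊕-comm n x (⊖_ n x)) ⟩
        _⊕_ n (_⊕_ n (⊖_ n x) x) y  ≡⟨ ≡.cong (λ z → _⊕_ n z y) (⊕-inverseˡ n x) ⟩
        _⊕_ n (𝟘 n) y               ≡⟨ ⊕-identityˡ n y ⟩
        y                           ∎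
        where open ≡.≡-Reasoning

      -- Since `p` divides `n`, reducing modulo `n` does not change residues modulo `p`.
      [x+d]%p≡y%p : (toℕ x ℕ.+ toℕ d) % p ≡ toℕ y % p
      [x+d]%p≡y%p = begin
        (toℕ x ℕ.+ toℕ d) % p      ≡⟨ m∣n⇒o%n%m≡o%m p n _ p∣n ⟨
        (toℕ x ℕ.+ toℕ d) % n % p  ≡⟨ ≡.cong (_% p) (toℕ-mod n _) ⟨
        toℕ (_⊕_ n x d) % p        ≡⟨ ≡.cong (λ z → toℕ z % p) x⊕d≡y ⟩
        toℕ y % p                  ∎
        where open ≡.≡-Reasoning

    ∣difference⇒≡% : p ∣ toℕ d → toℕ x % p ≡ toℕ y % p
    ∣difference⇒≡% p∣d = ≡.trans (≡.sym (%-remove-+ʳ (toℕ x) p∣d)) [x+d]%p≡y%p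

    ≡%⇒∣difference : toℕ x % p ≡ toℕ y % p → p ∣ toℕ d
    ≡%⇒∣difference eq = [m+n]%p≡m%p⇒p∣n (toℕ x) (toℕ d) (≡.trans [x+d]%p≡y%p (≡.sym eq))

-- Cancellation and roots in Heyting fields.

module HeytingFieldRoots (K : HeytingField c ℓ₁ ℓ₂) where
  open HeytingField K
  open HeytingProperties heytingCommutativeRing
  open CommutativeRing (HeytingCommutativeRing.commutativeRing heytingCommutativeRing) using (ring)
  open RingProperties ring using (x∙y⁻¹≈ε⇒x≈y)

  -- Apartness is invertibility of the difference, and `x - y - 0#` has the same inverse as `x - y`.
  x-y#0⇒x#y : ∀ {x y} → x - y # 0# → x # y
  x-y#0⇒x#y {x} {y} x-y#0 with #⇒invertible x-y#0
  ... | u , u*[x-y-0]≈1 , _ =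
    invertibleˡ⇒# (u , trans (*-congˡ (sym (x-0≈x (x - y)))) u*[x-y-0]≈1)

  x#y⇒x-y#0 : ∀ {x y} → x # y → x - y # 0#
  x#y⇒x-y#0 {x} {y} x#y with #⇒invertible x#y
  ... | u , u*[x-y]≈1 , _ =
    invertibleˡ⇒# (u , trans (*-congˡ (x-0≈x (x - y))) u*[x-y]≈1)

  -- If `x` were apart from zero, so would be the product; tightness turns this refutation into
  -- equality.
  x*y≈0∧y#0⇒x≈0 : ∀ {x y} → x * y ≈ 0# → y # 0# → x ≈ 0#
  x*y≈0∧y#0⇒x≈0 {x} xy≈0 y#0 =
    proj₁ (tight x 0#) λ x#0 → #-irrefl xy≈0 (x#0y#0→xy#0 x#0 y#0)

  x*y≈0∧x#0⇒y≈0 : ∀ {x y} → x * y ≈ 0# → x # 0# → y ≈ 0#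
  x*y≈0∧x#0⇒y≈0 {x} {y} xy≈0 = x*y≈0∧y#0⇒x≈0 (trans (*-comm y x) xy≈0)

  -- Equality with a root is not decidable; cotransitivity instead selects a factor that can be
  -- cancelled.
  root₂ : ∀ {μ a b} → a # b → (μ - a) * (μ - b) ≈ 0# → μ ≈ a ⊎ μ ≈ b
  root₂ {μ} {a} {b} a#b eq with #-cotrans a#b μ
  ... | inj₁ a#μ = inj₂ (x∙y⁻¹≈ε⇒x≈y μ b (x*y≈0∧x#0⇒y≈0 eq (x#y⇒x-y#0 (#-sym a#μ))))
  ... | inj₂ μ#b = inj₁ (x∙y⁻¹≈ε⇒x≈y μ a (x*y≈0∧y#0⇒x≈0 eq (x#y⇒x-y#0 μ#b)))

  root₃ : ∀ {μ a b c} → a # b → a # c → b # c →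
          (μ - a) * ((μ - b) * (μ - c)) ≈ 0# → μ ≈ a ⊎ μ ≈ b ⊎ μ ≈ c
  root₃ {μ} {a} {b} {c} a#b a#c b#c eq with #-cotrans a#b μ
  ... | inj₁ a#μ = inj₂ (root₂ b#c (x*y≈0∧x#0⇒y≈0 eq (x#y⇒x-y#0 (#-sym a#μ))))
  ... | inj₂ μ#b = Sum.map₂ inj₂ (root₂ a#c (x*y≈0∧y#0⇒x≈0 eq′ (x#y⇒x-y#0 μ#b)))
    where
    -- The cancellable factor is moved to the end.
    eq′ : (μ - a) * (μ - c) * (μ - b) ≈ 0#
    eq′ = trans (*-assoc (μ - a) (μ - c) (μ - b)) (trans (*-congˡ (*-comm (μ - c) (μ - b))) eq)

-- Indicators and finite sums.

module Sums (R : CommutativeRing c ℓ₁) where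
  open CommutativeRing R hiding (zero)
  open RingProperties ring using (+-cancelʳ; x≈y⇒x∙y⁻¹≈ε; -‿distribˡ-*)
  open SemiringMult semiring using (_×_; ×-assoc-*; ×-congʳ)
  open SemiringSum semiring
  open SetoidReasoning setoid

  -- Has the shape of an entry of `adjacencyMatrix`, so those entries are indicators by computation.
  indicator : ∀ {a} {P : Set a} → Dec P → Carrier
  indicator P? = if does P? then 1# else 0#

  indicator-complement : ∀ {a b} {P : Set a} {Q : Set b} (P? : Dec P) (Q? : Dec Q) →
                         (P → ¬ Q) → (¬ P → Q) → indicator P? + indicator Q? ≈ 1#
  indicator-complement (yes x) (yes y) P⇒¬Q ¬P⇒Q = contradiction y (P⇒¬Q x)
  indicator-complement (yes x) (no ¬y) P⇒¬Q ¬P⇒Q = +-identityʳ 1#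
  indicator-complement (no ¬x) (yes y) P⇒¬Q ¬P⇒Q = +-identityˡ 1#
  indicator-complement (no ¬x) (no ¬y) P⇒¬Q ¬P⇒Q = contradiction (¬P⇒Q ¬x) ¬y

  indicator-cong : ∀ {a b} {P : Set a} {Q : Set b} (P? : Dec P) (Q? : Dec Q) →
                   (P → Q) → (Q → P) → indicator P? ≈ indicator Q?
  indicator-cong (yes x) (yes y) P⇒Q Q⇒P = refl
  indicator-cong (yes x) (no ¬y) P⇒Q Q⇒P = contradiction (P⇒Q x) ¬y
  indicator-cong (no ¬x) (yes y) P⇒Q Q⇒P = contradiction (Q⇒P y) ¬x
  indicator-cong (no ¬x) (no ¬y) P⇒Q Q⇒P = refl

  indicator-*-congˡ : ∀ {a} {P : Set a} (P? : Dec P) {x y} → (P → x ≈ y) →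
                      indicator P? * x ≈ indicator P? * y
  indicator-*-congˡ (yes h) P⇒x≈y = *-congˡ (P⇒x≈y h)
  indicator-*-congˡ (no ¬h) P⇒x≈y = trans (zeroˡ _) (sym (zeroˡ _))

  -- Summands live on ℕ, so that shifting indices or rewriting the length needs no transport between
  -- `Fin` types.
  sumBelow : ℕ → (ℕ → Carrier) → Carrier
  sumBelow n f = ∑[ i < n ] f (toℕ i)

  sumBelow-+ : ∀ a b f → sumBelow (a ℕ.+ b) f ≈ sumBelow a f + sumBelow b (f ∘ (a ℕ.+_))
  sumBelow-+ zero    b f = sym (+-identityˡ _)
  sumBelow-+ (suc a) b f = trans (+-congˡ (sumBelow-+ a b (f ∘ suc))) (sym (+-assoc _ _ _))

  sumBelow-periodic : ∀ p k f → (∀ i → f (p ℕ.+ i) ≈ f i) →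
                      sumBelow (k ℕ.* p) f ≈ k × sumBelow p f
  sumBelow-periodic p zero    f periodic = refl
  sumBelow-periodic p (suc k) f periodic = begin
    sumBelow (p ℕ.+ k ℕ.* p) f                           ≈⟨ sumBelow-+ p (k ℕ.* p) f ⟩
    sumBelow p f + sumBelow (k ℕ.* p) (f ∘ (p ℕ.+_))     ≈⟨ +-congˡ (sum-cong-≋ {k ℕ.* p} (λ i → periodic (toℕ i))) ⟩
    sumBelow p f + sumBelow (k ℕ.* p) f                  ≈⟨ +-congˡ (sumBelow-periodic p k f periodic) ⟩
    sumBelow p f + k × sumBelow p f                      ∎

  sumBelow-indicator-≟ : ∀ {p r} → r < p → sumBelow p (λ i → indicator (r ℕ.≟ i)) ≈ 1#
  sumBelow-indicator-≟ {suc p} {zero}  r<p =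
    trans (+-congˡ (sum-replicate-zero p)) (+-identityʳ 1#)
  -- The first term is zero, and the test `suc r ≟ suc i` computes to the same boolean as `r ≟ i`.
  sumBelow-indicator-≟ {suc p} {suc r} r<p =
    trans (+-identityˡ _) (sumBelow-indicator-≟ (s<s⁻¹ r<p))

  -- The matrix of congruence modulo `p`.

  module Congruence (p k : ℕ) .{{_ : NonZero p}} where

    E : Fin (p ℕ.* k) → Fin (p ℕ.* k) → Carrier
    E x y = indicator (toℕ x % p ℕ.≟ toℕ y % p)

    E-sym : ∀ x y → E x y ≈ E y x
    E-sym x y = indicator-cong (toℕ x % p ℕ.≟ toℕ y % p) (toℕ y % p ℕ.≟ toℕ x % p) ≡.sym ≡.sym

    -- Both sides vanish unless `x` and `y` are congruent, and then their rows coincide.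
    E-trans : ∀ x y z → E x y * E y z ≈ E x y * E x z
    E-trans x y z = indicator-*-congˡ (toℕ x % p ℕ.≟ toℕ y % p)
      λ x≡y → reflexive (≡.cong (λ r → indicator (r ℕ.≟ toℕ z % p)) (≡.sym x≡y))

    -- The index range consists of `k` periods of length `p`, each meeting the class of `x` once.
    E-rowSum : ∀ x → sum (E x) ≈ k × 1#
    E-rowSum x = begin
      sumBelow (p ℕ.* k) f  ≡⟨ ≡.cong (λ n → sumBelow n f) (ℕ.*-comm p k) ⟩
      sumBelow (k ℕ.* p) f  ≈⟨ sumBelow-periodic p k f periodic ⟩
      k × sumBelow p f      ≈⟨ ×-congʳ k (trans (sum-cong-≋ reduced) (sumBelow-indicator-≟ (m%n<n (toℕ x) p))) ⟩
      k × 1#                ∎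
      where
      f : ℕ → Carrier
      f i = indicator (toℕ x % p ℕ.≟ i % p)

      periodic : ∀ i → f (p ℕ.+ i) ≈ f i
      periodic i = reflexive (≡.cong (λ j → indicator (toℕ x % p ℕ.≟ j)) (%-remove-+ˡ i ∣-refl))

      reduced : ∀ (i : Fin p) → f (toℕ i) ≈ indicator (toℕ x % p ℕ.≟ toℕ i)
      reduced i = reflexive (≡.cong (λ j → indicator (toℕ x % p ℕ.≟ j)) (m<n⇒m%n≡m (toℕ<n i)))

  -- Eigenvectors of J - E over a commutative ring.

  module EquitablePartition
    {n : ℕ} {A E : Fin n → Fin n → Carrier} {Q D μ : Carrier} {v : Vector Carrier n}
    (A+E≈J : ∀ x y → A x y + E x y ≈ 1#)
    (E-sym : ∀ x y → E x y ≈ E y x)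
    (E-trans : ∀ x y z → E x y * E y z ≈ E x y * E x z)
    (E-rowSum : ∀ x → sum (E x) ≈ Q)
    (n≈Q+D : n × 1# ≈ Q + D)
    (Av≈μv : ∀ x → ∑[ y < n ] (A x y * v y) ≈ μ * v x)
    where

    private
      s : Carrier
      s = sum v

      b : Vector Carrier n
      b x = ∑[ y < n ] (E x y * v y)

    -- Entry `x` of J v = A v + E v.
    s≈μv+b : ∀ x → s ≈ μ * v x + b x
    s≈μv+b x = begin
      s                                             ≈⟨ sum-cong-≋ split ⟩
      ∑[ y < n ] (A x y * v y + E x y * v y)        ≈⟨ ∑-distrib-+ (λ y → A x y * v y) (λ y → E x y * v y) ⟩
      ∑[ y < n ] (A x y * v y) + b x                ≈⟨ +-congʳ (Av≈μv x) ⟩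
      μ * v x + b x                                 ∎
      where
      split : ∀ y → v y ≈ A x y * v y + E x y * v y
      split y = begin
        v y                            ≈⟨ *-identityˡ (v y) ⟨
        1# * v y                       ≈⟨ *-congʳ (A+E≈J x y) ⟨
        (A x y + E x y) * v y          ≈⟨ distribʳ (v y) (A x y) (E x y) ⟩
        A x y * v y + E x y * v y      ∎

    -- Exchanging the sums produces column sums of `E`, which equal row sums by symmetry.
    sum-b : sum b ≈ Q * s
    sum-b = begin
      ∑[ x < n ] ∑[ y < n ] (E x y * v y)     ≈⟨ ∑-comm (λ x y → E x y * v y) ⟩
      ∑[ y < n ] ∑[ x < n ] (E x y * v y)     ≈⟨ sum-cong-≋ (λ y → *-distribʳ-sum (v y) (λ x → E x y)) ⟨
      ∑[ y < n ] (∑[ x < n ] E x y * v y)     ≈⟨ sum-cong-≋ (λ y → *-congʳ (trans (sum-cong-≋ (λ x → E-sym x y)) (E-rowSum y))) ⟩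
      ∑[ y < n ] (Q * v y)                    ≈⟨ *-distribˡ-sum Q v ⟨
      Q * s                                   ∎

    -- Summing `s≈μv+b` over all indices gives (Q + D) s = μ s + Q s.
    Ds≈μs : D * s ≈ μ * s
    Ds≈μs = +-cancelʳ (Q * s) (D * s) (μ * s) (begin
      D * s + Q * s                     ≈⟨ +-comm _ _ ⟩
      Q * s + D * s                     ≈⟨ distribʳ s Q D ⟨
      (Q + D) * s                       ≈⟨ *-congʳ n≈Q+D ⟨
      n × 1# * s                        ≈⟨ ×-assoc-* n 1# s ⟩
      n × (1# * s)                      ≈⟨ ×-congʳ n (*-identityˡ s) ⟩
      n × s                             ≈⟨ sum-replicate n ⟨
      ∑[ x < n ] s                      ≈⟨ sum-cong-≋ s≈μv+b ⟩
      ∑[ x < n ] (μ * v x + b x)        ≈⟨ ∑-distrib-+ _ b ⟩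
      ∑[ x < n ] (μ * v x) + sum b      ≈⟨ +-cong (sym (*-distribˡ-sum μ v)) sum-b ⟩
      μ * s + Q * s                     ∎)

    -- The weights `E z x` restrict the sum of `s≈μv+b` to the class of `z`, on which `b` is
    -- constant.
    Qs≈[μ+Q]b : ∀ z → Q * s ≈ (μ + Q) * b z
    Qs≈[μ+Q]b z = begin
      Q * s                                                      ≈⟨ *-congʳ (E-rowSum z) ⟨
      sum (E z) * s                                              ≈⟨ *-distribʳ-sum s (E z) ⟩
      ∑[ x < n ] (E z x * s)                                     ≈⟨ sum-cong-≋ restrict ⟩
      ∑[ x < n ] (μ * (E z x * v x) + E z x * b z)               ≈⟨ ∑-distrib-+ (λ x → μ * (E z x * v x)) (λ x → E z x * b z) ⟩
      ∑[ x < n ] (μ * (E z x * v x)) + ∑[ x < n ] (E z x * b z)  ≈⟨ +-cong (*-distribˡ-sum μ (λ x → E z x * v x)) (*-distribʳ-sum (b z) (E z)) ⟨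
      μ * b z + sum (E z) * b z                                  ≈⟨ +-congˡ (*-congʳ (E-rowSum z)) ⟩
      μ * b z + Q * b z                                          ≈⟨ distribʳ (b z) μ Q ⟨
      (μ + Q) * b z                                              ∎
      where
      b-constant : ∀ x → E z x * b x ≈ E z x * b z
      b-constant x = begin
        E z x * b x                             ≈⟨ *-distribˡ-sum (E z x) (λ y → E x y * v y) ⟩
        ∑[ y < n ] (E z x * (E x y * v y))      ≈⟨ sum-cong-≋ (λ y → trans (sym (*-assoc _ _ _)) (trans (*-congʳ (E-trans z x y)) (*-assoc _ _ _))) ⟩
        ∑[ y < n ] (E z x * (E z y * v y))      ≈⟨ *-distribˡ-sum (E z x) (λ y → E z y * v y) ⟨
        E z x * b z                             ∎

      restrict : ∀ x → E z x * s ≈ μ * (E z x * v x) + E z x * b z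
      restrict x = begin
        E z x * s                            ≈⟨ *-congˡ (s≈μv+b x) ⟩
        E z x * (μ * v x + b x)              ≈⟨ distribˡ _ _ _ ⟩
        E z x * (μ * v x) + E z x * b x      ≈⟨ +-cong (trans (sym (*-assoc _ _ _)) (trans (*-congʳ (*-comm _ _)) (*-assoc _ _ _))) (b-constant x) ⟩
        μ * (E z x * v x) + E z x * b z      ∎

    -- Multiply `s≈μv+b` by `μ + Q` and replace the term in `b` by `Q * s`.
    [μ+Q]μv≈μs : ∀ x → (μ + Q) * (μ * v x) ≈ μ * s
    [μ+Q]μv≈μs x = +-cancelʳ (Q * s) _ _ (begin
      (μ + Q) * (μ * v x) + Q * s              ≈⟨ +-congˡ (Qs≈[μ+Q]b x) ⟩
      (μ + Q) * (μ * v x) + (μ + Q) * b x      ≈⟨ distribˡ _ _ _ ⟨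
      (μ + Q) * (μ * v x + b x)                ≈⟨ *-congˡ (s≈μv+b x) ⟨
      (μ + Q) * s                              ≈⟨ distribʳ s μ Q ⟩
      μ * s + Q * s                            ∎)

    -- The factor `(μ + Q) * μ` turns `v x` into `μ * s`, which `μ - D` kills by `Ds≈μs`.
    annihilates : ∀ x → (μ - D) * ((μ + Q) * μ) * v x ≈ 0#
    annihilates x = begin
      (μ - D) * ((μ + Q) * μ) * v x      ≈⟨ *-assoc _ _ _ ⟩
      (μ - D) * ((μ + Q) * μ * v x)      ≈⟨ *-congˡ (trans (*-assoc _ _ _) ([μ+Q]μv≈μs x)) ⟩
      (μ - D) * (μ * s)                  ≈⟨ distribʳ (μ * s) μ (- D) ⟩
      μ * (μ * s) + - D * (μ * s)        ≈⟨ +-congˡ (-‿distribˡ-* D (μ * s)) ⟨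
      μ * (μ * s) - D * (μ * s)          ≈⟨ x≈y⇒x∙y⁻¹≈ε (sym (trans (sym (*-assoc D μ s)) (trans (*-congʳ (*-comm D μ)) (trans (*-assoc μ D s) (*-congˡ Ds≈μs))))) ⟩
      0#                                 ∎

-- Integrality of the roots in characteristic zero.

module _ (K : HeytingField c ℓ₁ ℓ₂) (char0 : CharacteristicZero K) where
  open HeytingField K
  open HeytingProperties heytingCommutativeRing using (#-congʳ; x-0≈x)
  open HeytingFieldRoots K
  open CommutativeRing (HeytingCommutativeRing.commutativeRing heytingCommutativeRing) using (ring; semiring)
  open RingProperties ring using (-0#≈0#; -‿involutive)
  open SemiringMult semiring using (_×_; ×-homo-+)

  ×1#0 : ∀ k → .{{NonZero k}} → k × 1# # 0#
  ×1#0 (suc k) = char0 k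

  fromℤ-neg : ∀ k → - (k × 1#) ≈ fromℤ K (ℤ.- (+ k))
  fromℤ-neg zero    = -0#≈0#
  fromℤ-neg (suc k) = refl

  -- The roots d, -q and 0 are pairwise apart, since d, q and d + q are positive multiples of one.
  integerRoot : ∀ {μ} q d → .{{NonZero q}} → .{{NonZero d}} →
                (μ - d × 1#) * ((μ + q × 1#) * μ) ≈ 0# → IsInteger K μ
  integerRoot {μ} q d eq with root₃ d#-q d#0 -q#0 factored
    where
    x--y≈x+y : ∀ {x y} → x - (- y) ≈ x + y
    x--y≈x+y = +-congˡ (-‿involutive _)

    -q#0 : - (q × 1#) # 0#
    -q#0 = #-sym (x-y#0⇒x#y (#-congʳ (sym (trans x--y≈x+y (+-identityˡ _))) (×1#0 q)))

    d#0 : d × 1# # 0#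
    d#0 = ×1#0 d

    d#-q : d × 1# # - (q × 1#)
    d#-q = x-y#0⇒x#y (#-congʳ (trans (×-homo-+ 1# d q) (sym x--y≈x+y))
                              (×1#0 (d ℕ.+ q) {{ℕ.>-nonZero (ℕ.<-≤-trans (ℕ.>-nonZero⁻¹ d) (ℕ.m≤m+n d q))}}))

    factored : (μ - d × 1#) * ((μ - (- (q × 1#))) * (μ - 0#)) ≈ 0#
    factored = trans (*-congˡ (*-cong x--y≈x+y (x-0≈x μ))) eq
  ... | inj₁ μ≈d         = + d , μ≈d
  ... | inj₂ (inj₁ μ≈-q) = ℤ.- (+ q) , trans μ≈-q (fromℤ-neg q)
  ... | inj₂ (inj₂ μ≈0)  = + 0 , μ≈0

-- Application to the residues coprime to a prime power.

proposition3p2 : ∀ {c ℓ₁ ℓ₂ : Level} (p m : ℕ) (p-prime : Prime p) (m≥1 : m ≥ 1) →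
    let n = p ^ m
        n≢0 = primePower-nonZero m p-prime
        S = coprimeResidues n {{n≢0}} (1<primePower p-prime m≥1)
    in IsIntegral c ℓ₁ ℓ₂ (Cay (ℤmod n {{n≢0}}) S)
proposition3p2 zero _ p-prime = contradiction p-prime ¬prime[0]
proposition3p2 (suc zero) _ p-prime = contradiction p-prime ¬prime[1]
proposition3p2 p@(suc (suc p-2)) m@(suc k) p-prime m≥1 K char0 μ (v , (i , vᵢ#0) , Av≈μv) =
  -- The entry `v i`, apart from zero, is cancelled, leaving a cubic equation in `μ`.
  integerRoot K char0 q d (x*y≈0∧y#0⇒x≈0 (annihilates i) vᵢ#0)
  where
  open HeytingField K using (1#; _+_; _≈_; heytingCommutativeRing)
  open HeytingFieldRoots K using (x*y≈0∧y#0⇒x≈0)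
  open CommutativeRing (HeytingCommutativeRing.commutativeRing heytingCommutativeRing) using (semiring)
  open SemiringMult semiring using (×-homo-+)
  open Sums (HeytingCommutativeRing.commutativeRing heytingCommutativeRing)

  q d : ℕ
  q = p ^ k
  -- This is (p - 1) q, positive because p is at least 2; `p ^ m` unfolds to `q ℕ.+ d`.
  d = suc p-2 ℕ.* q

  instance
    n≢0 : NonZero (p ^ m)
    n≢0 = primePower-nonZero m p-prime
    q≢0 : NonZero q
    q≢0 = primePower-nonZero k p-prime
    d≢0 : NonZero d
    d≢0 = ℕ.m*n≢0 (suc p-2) q

  open Congruence p q

  Γ : SimpleGraph
  Γ = Cay (ℤmod (p ^ m)) (coprimeResidues (p ^ m) (1<primePower p-prime m≥1))

  p∣n : p ∣ p ^ m
  p∣n = m∣m*n q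

  A+E≈J : ∀ x y → adjacencyMatrix K Γ x y + E x y ≈ 1#
  A+E≈J x y = indicator-complement (SimpleGraph.adj? Γ x y) (toℕ x % p ℕ.≟ toℕ y % p)
    -- Otherwise `p` divides both the difference and `p ^ m`, forcing p = 1.
    (λ coprime x≡y → contradiction
      (gcd≡1⇒coprime coprime (≡%⇒∣difference p∣n x y x≡y , p∣n)) (λ ()))
    -- If the residues differed, `p` would not divide the difference, making it coprime to `p ^ m`.
    (λ ¬coprime → decidable-stable (toℕ x % p ℕ.≟ toℕ y % p)
      λ x≢y → ¬coprime (coprime⇒gcd≡1 (∤⇒coprime-^ m p-prime (x≢y ∘ ∣difference⇒≡% p∣n x y))))

  open EquitablePartition A+E≈J E-sym E-trans E-rowSum (×-homo-+ 1# q d) Av≈μv
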